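{- Every rooted tree of radius less than or equal to $7$ is long-repetition-free $2$-colorable.
   Context: A word $\bar w$ is a long square if $\bar w = \bar u\bar u$ for some word $\bar u$ with $|\bar u| \ge 3$. A word is long-square-free if it contains no sub-word (that is, no block of consecutive letters) that is a long square. A simple connected graph $G=(V,E)$ is long-repetition-free $k$-colorable if there exists a coloring $\chi : V \to \{1,\dots,k\}$ (any map; adjacent vertices may receive the same color) such that for every path in $G$ with successive vertices $u_1,\dots,u_n$ (a path has pairwise distinct vertices), the word $\chi(u_1)\cdots\chi(u_n)$ is long-square-free. The distance between two vertices of a connected graph is the number of edges in a shortest path between them; the eccentricity of a vertex is the maximum distance from it to any other vertex; the radius of the graph is the minimum eccentricity of its vertices. A rooted tree is a tree with one distinguished vertex, called the root (the radius does not depend on the root). -}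

module Defs where

open import Level using (Level; _⊔_) renaming (suc to lsuc)
open import Data.Fin.Base using (Fin)
open import Data.List.Base using (List; _∷_; _++_; _∷ʳ_; head; last; length; map)
open import Data.List.Relation.Binary.Infix.Heterogeneous using (Infix)
open import Data.List.Relation.Unary.Linked using (Linked)
open import Data.List.Relation.Unary.Unique.Propositional using (Unique)
open import Data.Maybe.Base using (just)
open import Data.Nat.Base using (ℕ; suc; _≤_)
open import Data.Product.Base using (∃; ∃-syntax; Σ-syntax; _×_)
open import Relation.Binary.Core using (Rel)
open import Relation.Binary.Definitions using (Irreflexive; Symmetric)
open import Relation.Binary.PropositionalEquality.Core using (_≡_)
open import Relation.Nullary.Negation.Core using (¬_)
open import Relation.Unary using (Pred)

private
  variable
    a p : Level

------------------------------------------------------------------------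
-- Words

LongSquare : {A : Set a} → List A → Set a
LongSquare w = ∃[ u ] 3 ≤ length u × w ≡ u ++ u

LongSquareFree : {A : Set a} → List A → Set a
LongSquareFree w = ∀ v → Infix _≡_ v w → ¬ LongSquare v

------------------------------------------------------------------------
-- Minima and maxima of sets of natural numbers

IsMin : Pred ℕ p → Pred ℕ p
IsMin P n = P n × (∀ m → P m → n ≤ m)

IsMax : Pred ℕ p → Pred ℕ p
IsMax P n = P n × (∀ m → P m → m ≤ n)

------------------------------------------------------------------------
-- Graphs

-- The vertex set is arbitrary: neither finiteness nor decidability of
-- equality or adjacency is assumed.

record SimpleGraph a ℓ : Set (lsuc (a ⊔ ℓ)) where
  infix 4 _~_
  field
    Vertex   : Set a
    _~_      : Rel Vertex ℓ
    ~-sym    : Symmetric _~_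
    ~-irrefl : Irreflexive _≡_ _~_

module _ {a ℓ} (G : SimpleGraph a ℓ) where
  open SimpleGraph G

  IsPath : List Vertex → Set (a ⊔ ℓ)
  IsPath us = Linked _~_ us × Unique us

  -- "There is a path with n edges from u to v": such a path has
  -- suc n vertices.
  PathOfLength : Vertex → Vertex → ℕ → Set (a ⊔ ℓ)
  PathOfLength u v n =
    ∃[ us ] IsPath us × head us ≡ just u × last us ≡ just v × length us ≡ suc n

  Connected : Set (a ⊔ ℓ)
  Connected = ∀ u v → ∃ (PathOfLength u v)

  -- A cycle is a path u ∷ us on at least three vertices whose last
  -- vertex is adjacent to u.
  IsCycle : Vertex → List Vertex → Set (a ⊔ ℓ)
  IsCycle u us = 2 ≤ length us × Unique (u ∷ us) × Linked _~_ ((u ∷ us) ∷ʳ u)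

  Acyclic : Set (a ⊔ ℓ)
  Acyclic = ∀ u us → ¬ IsCycle u us

  -- Distance, eccentricity and radius are relations rather than functions,
  -- as the minima and maxima need not be computable (or even exist) for an
  -- arbitrary graph: "IsDistance u v d" says that the distance from u to v
  -- is d, and so on.

  IsDistance : Vertex → Vertex → ℕ → Set (a ⊔ ℓ)
  IsDistance u v = IsMin (PathOfLength u v)

  -- The vertex v itself, at distance 0, is included in the maximum; this
  -- only matters for the one-vertex graph, whose eccentricity is then 0.
  IsEccentricity : Vertex → ℕ → Set (a ⊔ ℓ)
  IsEccentricity v = IsMax (λ d → ∃[ w ] IsDistance v w d)

  IsRadius : ℕ → Set (a ⊔ ℓ)
  IsRadius = IsMin (λ e → ∃[ v ] IsEccentricity v e)

  LongRepetitionFreeColorable : ℕ → Set (a ⊔ ℓ)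
  LongRepetitionFreeColorable k =
    Σ[ χ ∈ (Vertex → Fin k) ] (∀ us → IsPath us → LongSquareFree (map χ us))

record RootedTree a ℓ : Set (lsuc (a ⊔ ℓ)) where
  field
    graph     : SimpleGraph a ℓ
    connected : Connected graph
    acyclic   : Acyclic graph
    root      : SimpleGraph.Vertex graph

{-# OPTIONS --safe #-}

-- Root the tree at a centre o and color each vertex by its distance from o,
-- using the word 0 0 0 1 0 1 1 1 for the distances 0, …, 7. In a tree, a path
-- runs towards o and then away from o, so its distances from o decrease by 1
-- down to some j and then increase by 1. This leaves finitely many
-- words, each of which is checked to be long-square-free by evaluation.

module Submission where

open import Defs
open import Data.Fin.Base using (Fin)
open import Data.Fin.Patterns using (0F; 1F)
import Data.Fin.Properties as Fin
open import Data.List.Base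
  using (List; []; _∷_; _++_; drop; head; last; length; map; reverse; reverseAcc; tails; take)
open import Data.List.Membership.Propositional using (_∈_; _∉_)
open import Data.List.Properties
  using (length-++; length-reverse; map-∘; ++-assoc; ∷-injective)
open import Data.List.Relation.Binary.Infix.Heterogeneous using (here; there)
open import Data.List.Relation.Binary.Permutation.Propositional using (↭⇒↭ₛ; ↭-sym)
open import Data.List.Relation.Binary.Permutation.Propositional.Properties using (↭-reverse)
open import Data.List.Relation.Binary.Permutation.Setoid.Properties using (Unique-resp-↭)
open import Data.List.Relation.Binary.Pointwise using (Pointwise-≡⇒≡; ≡⇒Pointwise-≡)
open import Data.List.Relation.Binary.Prefix.Heterogeneous
  using (Prefix; toView; fromView) renaming (_++_ to _++ᵛ_)
open import Data.List.Relation.Binary.Prefix.Heterogeneous.Properties using (prefix?)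
open import Data.List.Relation.Unary.All as All using (All; []; _∷_; all?; lookup)
open import Data.List.Relation.Unary.All.Properties using (¬Any⇒All¬)
open import Data.List.Relation.Unary.AllPairs using ([]; _∷_)
open import Data.List.Relation.Unary.Any using (here; there)
open import Data.List.Relation.Unary.Any.Properties using (reverse⁻)
open import Data.List.Relation.Unary.Linked using (Linked; []; [-]; _∷_)
import Data.List.Relation.Unary.Linked.Properties as Linked
open import Data.Maybe.Base using (just)
open import Data.Maybe.Properties using (just-injective)
open import Data.Maybe.Relation.Binary.Connected as Maybe using (just; just-nothing)
open import Data.Nat.Base using (ℕ; zero; suc; _+_; _≤_; _<_; z≤n; s≤s; s≤s⁻¹)
open import Data.Nat.Properties
open import Data.Product.Base using (∃-syntax; _×_; _,_; proj₁; proj₂)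
open import Data.Sum.Base using (_⊎_; inj₁; inj₂; map₁)
open import Function.Base using (_∘_; case_of_)
open import Relation.Binary.Core using (Rel)
open import Relation.Binary.Definitions using (DecidableEquality; Symmetric)
open import Relation.Binary.PropositionalEquality
  using (_≡_; _≢_; refl; sym; trans; cong; cong₂; subst; subst₂; setoid)
open import Relation.Nullary.Decidable
  using (yes; no; _⊎-dec_; _→-dec_; ¬?; decidable-stable; from-yes; ¬¬-excluded-middle)
open import Relation.Nullary.Negation using (¬_; contradiction)
open import Relation.Unary using (Decidable)

-- Ends and reversal of lists.

last∈ : ∀ {a} {A : Set a} {v : A} vs → last vs ≡ just v → v ∈ vs
last∈ (_ ∷ [])         refl = here refl
last∈ (_ ∷ vs@(_ ∷ _)) eq = there (last∈ vs eq)

module _ {a} {A : Set a} where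

  last-reverseAcc : ∀ (y : A) ys xs → last (reverseAcc (y ∷ ys) xs) ≡ last (y ∷ ys)
  last-reverseAcc y ys []       = refl
  last-reverseAcc y ys (x ∷ xs) = last-reverseAcc x (y ∷ ys) xs

  head-reverseAcc : ∀ ys (x : A) xs → head (reverseAcc ys (x ∷ xs)) ≡ last (x ∷ xs)
  head-reverseAcc ys x []        = refl
  head-reverseAcc ys x (x′ ∷ xs) = head-reverseAcc (x ∷ ys) x′ xs

  -- The two heads become neighbours at the next step of the reversal, so the relation must hold
  -- between them as well.
  Linked-reverseAcc : ∀ {ℓ} {R : Rel A ℓ} → Symmetric R → ∀ {xs ys} →
    Linked R xs → Maybe.Connected R (head xs) (head ys) → Linked R ys →
    Linked R (reverseAcc ys xs)
  Linked-reverseAcc sy [] _ rs = rs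
  Linked-reverseAcc sy {ys = []} [-] _ rs = [-]
  Linked-reverseAcc sy {ys = _ ∷ _} [-] (just r) rs = r ∷ rs
  Linked-reverseAcc sy {ys = []} (r′ ∷ rs′) _ _ = Linked-reverseAcc sy rs′ (just (sy r′)) [-]
  Linked-reverseAcc sy {ys = _ ∷ _} (r′ ∷ rs′) (just r) rs =
    Linked-reverseAcc sy rs′ (just (sy r′)) (r ∷ rs)

  -- Square-freeness as a decidable condition on prefixes.

  take-length-++ : ∀ (xs {ys} : List A) → take (length xs) (xs ++ ys) ≡ xs
  take-length-++ []       = refl
  take-length-++ (x ∷ xs) = cong (x ∷_) (take-length-++ xs)

  drop-length-++ : ∀ (xs {ys} : List A) → drop (length xs) (xs ++ ys) ≡ ys
  drop-length-++ []       = refl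
  drop-length-++ (_ ∷ xs) = drop-length-++ xs

  -- A word w begins with a square of half-length m < |w| exactly when take m w
  -- is a prefix of drop m w.
  NoLongSquarePrefix : List A → Set a
  NoLongSquarePrefix w =
    ∀ {m} → m < length w → 3 ≤ m → ¬ Prefix _≡_ (take m w) (drop m w)

  noLongSquarePrefix? : DecidableEquality A → Decidable NoLongSquarePrefix
  noLongSquarePrefix? _≟_ w =
    allUpTo? (λ m → (3 ≤? m) →-dec ¬? (prefix? _≟_ (take m w) (drop m w))) (length w)

  -- Take `m` to be `length u`: cutting `u ++ u ++ s` there leaves `u ++ s`, which again begins with
  -- `u`.
  longSquare⇒¬noLongSquarePrefix : ∀ (u : List A) s → 3 ≤ length u →
    ¬ NoLongSquarePrefix ((u ++ u) ++ s)
  longSquare⇒¬noLongSquarePrefix u s 3≤u free rewrite ++-assoc u u s =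
    free m<w 3≤u prefix
    where
    m<w : length u < length (u ++ u ++ s)
    m<w = begin-strict
      length u                         <⟨ m<m+n (length u) (≤-trans (s≤s z≤n) 3≤u) ⟩
      length u + length u              ≤⟨ +-monoʳ-≤ (length u) (m≤m+n (length u) (length s)) ⟩
      length u + (length u + length s) ≡⟨ cong (length u +_) (length-++ u) ⟨
      length u + length (u ++ s)       ≡⟨ length-++ u ⟨
      length (u ++ u ++ s)             ∎
      where open ≤-Reasoning

    prefix : Prefix _≡_ (take (length u) (u ++ u ++ s)) (drop (length u) (u ++ u ++ s))
    prefix = subst₂ (Prefix _≡_) (sym (take-length-++ u)) (sym (drop-length-++ u))
      (fromView (≡⇒Pointwise-≡ refl ++ᵛ s))

  -- An infix of `w` is a prefix of some tail of `w`.
  noLongSquarePrefixes⇒longSquareFree :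
    ∀ w → All NoLongSquarePrefix (tails w) → LongSquareFree w
  noLongSquarePrefixes⇒longSquareFree w free v (here pre) (u , 3≤u , refl)
    with toView pre
  ... | eq ++ᵛ s with refl ← Pointwise-≡⇒≡ eq = longSquare⇒¬noLongSquarePrefix u s 3≤u (All.head free)
  noLongSquarePrefixes⇒longSquareFree (x ∷ w) (_ ∷ free) v (there inf) sq =
    noLongSquarePrefixes⇒longSquareFree w free v inf sq

-- Depth words of paths and their coloring.

climb : ℕ → ℕ → List ℕ
climb j zero    = j ∷ []
climb j (suc l) = j ∷ climb (suc j) l

-- Here `j` is the least depth on the path, while `k` and `l` count the edges before and after the
-- vertex that attains it.
valley : ℕ → ℕ → ℕ → List ℕ
valley j zero    l = climb j l
valley j (suc k) l = suc k + j ∷ valley j k l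

head-valley : ∀ j k l → head (valley j k l) ≡ just (k + j)
head-valley j zero    zero    = refl
head-valley j zero    (suc _) = refl
head-valley j (suc _) _       = refl

color : ℕ → Fin 2
color 3 = 1F
color 5 = 1F
color 6 = 1F
color 7 = 1F
-- Covers 0, 1, 2 and 4; beyond 7 the value is arbitrary, as no such depth occurs.
color _ = 0F

valley-longSquareFree : ∀ j k l → k + j ≤ 7 → j + l ≤ 7 →
  LongSquareFree (map color (valley j k l))
valley-longSquareFree j k l k+j≤7 j+l≤7 =
  noLongSquarePrefixes⇒longSquareFree _
    (checked
      (s≤s (m+n≤o⇒m≤o j j+l≤7)) (s≤s (m+n≤o⇒m≤o k k+j≤7)) (s≤s (m+n≤o⇒n≤o j j+l≤7))
      k+j≤7 j+l≤7)
  where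
  checked : ∀ {j} → j < 8 → ∀ {k} → k < 8 → ∀ {l} → l < 8 → k + j ≤ 7 → j + l ≤ 7 →
    All NoLongSquarePrefix (tails (map color (valley j k l)))
  -- The bounds by 8 follow from the two sum bounds and make the search finite.
  checked = from-yes
    (allUpTo? (λ j → allUpTo? (λ k → allUpTo? (λ l →
      (k + j ≤? 7) →-dec (j + l ≤? 7) →-dec
      all? (noLongSquarePrefix? Fin._≟_) (tails (map color (valley j k l)))) 8) 8) 8)

-- Cutting, reversing and splicing paths.

module _ {a ℓ} (G : SimpleGraph a ℓ) where
  open SimpleGraph G

  Joins : List Vertex → Vertex → Vertex → Set _
  Joins us u v = IsPath G us × head us ≡ just u × last us ≡ just v

  joins-tail : ∀ {x y us u v} → Joins (x ∷ y ∷ us) u v → Joins (y ∷ us) y v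
  joins-tail ((_ ∷ linked , _ ∷ unique) , _ , end) = (linked , unique) , refl , end

  joins-∷ : ∀ {us x y v} → x ~ y → Joins us y v → x ∉ us → Joins (x ∷ us) x v
  joins-∷ {_ ∷ _} x~y ((linked , unique) , refl , end) x∉us =
    (x~y ∷ linked , ¬Any⇒All¬ _ x∉us ∷ unique) , refl , end

  joins-reverse : ∀ {us u v} → Joins us u v → Joins (reverse us) v u
  joins-reverse {u ∷ us} ((linked , unique) , refl , end) =
    ( Linked-reverseAcc ~-sym linked just-nothing []
    , Unique-resp-↭ (setoid _) (↭⇒↭ₛ (↭-sym (↭-reverse (u ∷ us)))) unique ) ,
    trans (head-reverseAcc [] u us) end ,
    last-reverseAcc u [] us

  -- The witness is the suffix of `us` that starts at `w`. Its length serves to compare depths, its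
  -- containment in `us` to splice paths.
  joins-from : ∀ {us u v w} → w ∈ us → Joins us u v →
    ∃[ ws ] Joins ws w v × length ws ≤ length us × (∀ {x} → x ∈ ws → x ∈ us)
  joins-from (here refl) (path , _ , end) = _ , (path , refl , end) , ≤-refl , λ i → i
  joins-from {_ ∷ _ ∷ _} (there w∈us) p
    with ws , q , ws≤us , ws⊆us ← joins-from w∈us (joins-tail p) =
    ws , q , m≤n⇒m≤1+n ws≤us , there ∘ ws⊆us

  -- Vertices have no decidable equality, so paths can be spliced only up to
  -- double negation.
  joins-splice : ∀ {us vs u v w} → Joins us u v → Joins vs v w →
    ¬ ¬ (∃[ ws ] Joins ws u w × (∀ {x} → x ∈ ws → x ∈ us ⊎ x ∈ vs))
  joins-splice {_ ∷ []} (_ , refl , refl) q k = k (_ , q , inj₂)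
  joins-splice {x ∷ _ ∷ _} p@((x~y ∷ _ , _) , refl , _) q k =
    joins-splice (joins-tail p) q λ (ws , r , ws⊆) →
    ¬¬-excluded-middle {A = x ∈ ws} λ where
      -- The path already visits `x`, so starting from that visit cuts out the loop.
      (yes x∈ws) → let ts , t , _ , ts⊆ws = joins-from x∈ws r in
        k (ts , t , map₁ there ∘ ws⊆ ∘ ts⊆ws)
      (no x∉ws) → k (x ∷ ws , joins-∷ x~y r x∉ws , λ where
        (here refl) → inj₁ (here refl)
        (there z∈ws) → map₁ there (ws⊆ z∈ws))

  -- Uniqueness of paths in an acyclic graph.

  module _ (acyclic : Acyclic G) where

    -- If `ws` avoided `x`, then `x ∷ ws` would be a cycle; `y ≢ z` ensures that it has at least
    -- three vertices.
    no-detour : ∀ {x y z ws} → x ~ y → x ~ z → y ≢ z → Joins ws y z → ¬ x ∉ ws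
    no-detour {ws = _ ∷ []} x~y x~z y≢z (_ , refl , refl) x∉ws = y≢z refl
    no-detour {x} {ws = ws@(_ ∷ _ ∷ _)} x~y x~z y≢z ((linked , unique) , refl , end) x∉ws =
      acyclic x ws
        ( s≤s (s≤s z≤n)
        , ¬Any⇒All¬ _ x∉ws ∷ unique
        , x~y ∷ Linked.++⁺ linked
            (subst (λ m → Maybe.Connected _~_ m (just x)) (sym end) (just (~-sym x~z))) [-] )

    -- Going from `x` to `v` along one path and back to `y` along the other yields a path that
    -- avoids `u`, contrary to `no-detour`.
    second-unique : ∀ {u v x y us vs} →
      Joins (u ∷ x ∷ us) u v → Joins (u ∷ y ∷ vs) u v → ¬ x ≢ y
    second-unique p@((u~x ∷ _ , u∉us ∷ _) , _) q@((u~y ∷ _ , u∉vs ∷ _) , _) x≢y =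
      joins-splice (joins-tail p) (joins-reverse (joins-tail q)) λ (ws , r , ws⊆) →
      no-detour u~x u~y x≢y r λ u∈ws → case ws⊆ u∈ws of λ where
        (inj₁ u∈us) → lookup u∉us u∈us refl
        (inj₂ u∈vs) → lookup u∉vs (reverse⁻ u∈vs) refl

    joins-unique : ∀ {us vs u v} → Joins us u v → Joins vs u v → ¬ us ≢ vs
    joins-unique {_ ∷ []} {_ ∷ []} (_ , refl , refl) (_ , refl , refl) us≢vs = us≢vs refl
    joins-unique {_ ∷ []} {_ ∷ vs@(_ ∷ _)} (_ , refl , refl) ((_ , u∉ ∷ _) , refl , end) _ =
      lookup u∉ (last∈ vs end) refl
    joins-unique {_ ∷ us@(_ ∷ _)} {_ ∷ []} ((_ , u∉ ∷ _) , refl , end) (_ , refl , refl) _ =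
      lookup u∉ (last∈ us end) refl
    joins-unique {u ∷ _ ∷ _} {_ ∷ y ∷ vs} p@(_ , refl , _) q@(_ , refl , _) us≢vs =
      second-unique p q λ x≡y →
      joins-unique (joins-tail p) (subst (λ w → Joins (y ∷ vs) w _) (sym x≡y) (joins-tail q)) λ eq →
      us≢vs (cong (u ∷_) eq)

    -- Depths and how they vary along a path.

    module _ (connected : Connected G) (o : Vertex) where

      -- The length of the path that `connected` happens to choose. By `length-joins-root` every
      -- path to `o` has this length, so it is the distance to `o`.
      depth : Vertex → ℕ
      depth u = proj₁ (connected u o)

      joins-root : ∀ u → ∃[ us ] Joins us u o × length us ≡ suc (depth u)
      joins-root u with us , path , start , end , len ← proj₂ (connected u o) =
        us , (path , start , end) , len

      -- Equality of numbers is decidable, hence stable, so uniqueness up to double negation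
      -- suffices.
      length-joins-root : ∀ {us u} → Joins us u o → length us ≡ suc (depth u)
      length-joins-root {u = u} p with vs , q , len ← joins-root u =
        decidable-stable (_ ≟ _) λ neq →
          joins-unique p q λ { refl → neq len }

      ∉⇒depth : ∀ {x y us} → x ~ y → Joins us y o → x ∉ us → depth x ≡ suc (depth y)
      ∉⇒depth x~y p x∉us = sym (suc-injective
        (trans (cong suc (sym (length-joins-root p))) (length-joins-root (joins-∷ x~y p x∉us))))

      -- The path from `y` meets `x` after its first vertex, so its suffix from `x` is a strictly
      -- shorter path to `o`.
      ∈⇒depth : ∀ {x y us} → x ~ y → Joins us y o → x ∈ us → depth x < depth y
      ∈⇒depth x~y (_ , refl , _) (here refl) = contradiction x~y (~-irrefl refl)
      ∈⇒depth {us = _ ∷ _ ∷ _} x~y p (there x∈us)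
        with ws , q , ws≤us , _ ← joins-from x∈us (joins-tail p) =
        s≤s⁻¹ (subst₂ _≤_ (cong suc (length-joins-root q)) (length-joins-root p) (s≤s ws≤us))

      depth-~ : ∀ {x y} → x ~ y → depth x ≡ suc (depth y) ⊎ depth y ≡ suc (depth x)
      depth-~ {x} {y} x~y
        with us , p , _ ← joins-root x | vs , q , _ ← joins-root y =
        decidable-stable ((depth x ≟ suc (depth y)) ⊎-dec (depth y ≟ suc (depth x))) λ neither →
        ¬¬-excluded-middle {A = x ∈ vs} λ where
          (no x∉vs) → neither (inj₁ (∉⇒depth x~y q x∉vs))
          (yes x∈vs) → ¬¬-excluded-middle {A = y ∈ us} λ where
            (no y∉us) → neither (inj₂ (∉⇒depth (~-sym x~y) p y∉us))
            -- If each vertex lay on the other's path to `o`, each would be strictly less deep than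
            -- the other.
            (yes y∈us) → <-asym (∈⇒depth x~y q x∈vs) (∈⇒depth (~-sym x~y) p y∈us)

      -- Prepending `y` to the paths from `x` and `z` to `o` gives two paths from `y` to `o`; these
      -- coincide, hence so do their second vertices.
      parent-unique : ∀ {x y z} → x ~ y → z ~ y →
        depth y ≡ suc (depth x) → depth y ≡ suc (depth z) → ¬ x ≢ z
      parent-unique {y = y} x~y z~y y≡1+x y≡1+z x≢z
        with _ , p@(_ , p-start , _) , _ ← joins-root _
           | _ , q@(_ , q-start , _) , _ ← joins-root _ =
        joins-unique
          (joins-∷ (~-sym x~y) p (y∉ x~y p y≡1+x))
          (joins-∷ (~-sym z~y) q (y∉ z~y q y≡1+z))
          λ eq → x≢z (just-injective
            (trans (sym p-start) (trans (cong head (proj₂ (∷-injective eq))) q-start)))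
        where
        y∉ : ∀ {w ws} → w ~ y → Joins ws w o → depth y ≡ suc (depth w) → y ∉ ws
        y∉ w~y r y≡1+w y∈ws =
          <-asym (∈⇒depth (~-sym w~y) r y∈ws) (≤-reflexive (sym y≡1+w))

      no-peak : ∀ {x y z us} → IsPath G (x ∷ y ∷ z ∷ us) →
        depth y ≡ suc (depth x) → depth y ≢ suc (depth z)
      no-peak (x~y ∷ y~z ∷ _ , (_ ∷ x≢z ∷ _) ∷ _) y≡1+x y≡1+z =
        parent-unique x~y (~-sym y~z) y≡1+x y≡1+z x≢z

      depth≤eccentricity : ∀ {e} → IsEccentricity G o e → ∀ u → depth u ≤ e
      depth≤eccentricity (_ , bound) u
        with us , p , len ← joins-root u
        with path , start , end ← joins-reverse p =
        bound (depth u) (u ,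
          (reverse us , path , start , end , trans (length-reverse us) len) ,
          -- Minimality holds with equality: any path from `o` to `u`, once reversed, has length
          -- `depth u`.
          λ m (vs , path′ , start′ , end′ , len′) → ≤-reflexive (suc-injective
            (trans (sym (length-joins-root (joins-reverse (path′ , start′ , end′))))
              (trans (length-reverse vs) len′))))

      -- Induction on the path: a deeper new first vertex lengthens the descent; a shallower one is
      -- a new bottom, possible only if the rest merely climbs.
      path-depths : ∀ {d} → (∀ u → depth u ≤ d) → ∀ u us → IsPath G (u ∷ us) →
        ∃[ j ] ∃[ k ] ∃[ l ] map depth (u ∷ us) ≡ valley j k l × k + j ≤ d × j + l ≤ d
      path-depths {d} bound u [] _ =
        depth u , 0 , 0 , refl , bound u , subst (_≤ d) (sym (+-identityʳ _)) (bound u)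
      path-depths {d} bound u (v ∷ us) (u~v ∷ linked , u∉ ∷ unique)
        with path-depths bound v us (linked , unique) | depth-~ u~v
      ... | j , k , l , eq , k+j≤d , j+l≤d | inj₁ u≡1+v =
        j , suc k , l , cong₂ _∷_ u≡ eq , subst (_≤ d) u≡ (bound u) , j+l≤d
        where
        u≡ : depth u ≡ suc k + j
        u≡ = trans u≡1+v (cong suc (just-injective (trans (cong head eq) (head-valley j k l))))
      ... | j , zero , l , eq , _ , j+l≤d | inj₂ v≡1+u =
        depth u , 0 , suc l , cong (depth u ∷_) (trans eq (cong (λ i → climb i l) j≡)) , bound u ,
        subst (_≤ d) (trans (cong (_+ l) j≡) (sym (+-suc (depth u) l))) j+l≤d
        where
        j≡ : j ≡ suc (depth u)
        j≡ = trans (just-injective (trans (sym (head-valley j 0 l)) (sym (cong head eq)))) v≡1+u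
      -- The rest starts by descending, so `v` would be a peak between `u` and its successor.
      ... | j , suc k , l , eq , _ | inj₂ v≡1+u = contradiction (proj₂ (∷-injective eq))
        (peak-end us (u~v ∷ linked , u∉ ∷ unique))
        where
        peak-end : ∀ us → IsPath G (u ∷ v ∷ us) → map depth us ≢ valley j k l
        peak-end [] _ []≡ = contradiction (trans (cong head []≡) (head-valley j k l)) λ ()
        peak-end (_ ∷ _) path zs≡ = no-peak path v≡1+u (trans (proj₁ (∷-injective eq))
          (cong suc (sym (just-injective (trans (cong head zs≡) (head-valley j k l))))))

proposition2p2 : ∀ {a ℓ} (T : RootedTree a ℓ) (r : ℕ) →
    IsRadius (RootedTree.graph T) r → r ≤ 7 →
    LongRepetitionFreeColorable (RootedTree.graph T) 2
proposition2p2 T r ((o , eccentricity) , _) r≤7 = color ∘ depth′ , longSquareFree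
  where
  open RootedTree T
  depth′ = depth graph acyclic connected o

  depth≤7 : ∀ u → depth′ u ≤ 7
  depth≤7 u = ≤-trans (depth≤eccentricity graph acyclic connected o eccentricity u) r≤7

  longSquareFree : ∀ us → IsPath graph us → LongSquareFree (map (color ∘ depth′) us)
  -- The empty path is treated apart, since every valley is nonempty.
  longSquareFree [] _ = noLongSquarePrefixes⇒longSquareFree [] ((λ ()) ∷ [])
  longSquareFree (u ∷ us) path
    with j , k , l , eq , k+j≤7 , j+l≤7 ← path-depths graph acyclic connected o depth≤7 u us path =
    subst LongSquareFree (trans (cong (map color) (sym eq)) (sym (map-∘ (u ∷ us))))
      (valley-longSquareFree j k l k+j≤7 j+l≤7)
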